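{- Suppose that $F$ is a finite graph with at least two vertices. Then $\mathsf S_F\equiv_W\mathsf{LPO}$.
   Context: $\equiv_W$ denotes Weihrauch equivalence. Graphs have vertex set $\mathbb N$ (or are countable), given by characteristic functions of their edge sets. $\mathsf S_F$: given a graph $G$, output $1$ if $F$ is isomorphic to an (induced) subgraph of $G$, i.e. there is an injection of the vertices of $F$ into those of $G$ such that two vertices are adjacent in $F$ iff their images are adjacent in $G$, and output $0$ otherwise. $\mathsf{LPO}$: given $p:\mathbb N\to\mathbb N$, output $n$ such that if $n=0$ then $p(j)>0$ for all $j$, and if $n>0$ then $p(n-1)=0$ and $p(t)>0$ for all $t<n-1$. -}

module Defs where

open import Level using (0ℓ)
open import Data.Nat using (ℕ; zero; suc; _<_)
open import Data.Bool using (Bool; true; false)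
open import Data.Fin using (Fin)
open import Data.Maybe using (Maybe; just; nothing)
open import Data.Product using (Σ; _×_; _,_; ∃)
open import Data.Sum using (_⊎_)
open import Data.Empty using (⊥)
open import Relation.Nullary using (¬_)
open import Relation.Binary.PropositionalEquality using (_≡_)
open import Function.Definitions using (Injective)

-- Problems in the sense of Weihrauch reducibility, given directly on
-- names (elements of Baire-like spaces): a type of names of inputs,
-- a domain predicate, a discrete output type and a solution relation.

record Problem : Set₁ where
  field
    In  : Set
    Dom : In → Set
    Out : Set
    Sol : In → Out → Set

open Problem public

-- A partial computable function with discrete output, presented in stages:
-- ψ s = just b means "has halted with output b by stage s".
-- ψ converges to b if the first stage at which it halts yields b.
_⇓_ : {B : Set} → (ℕ → Maybe B) → B → Set
ψ ⇓ b = Σ ℕ λ s → (ψ s ≡ just b) × (∀ t → t < s → ψ t ≡ nothing)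

_≤W_ : Problem → Problem → Set
f ≤W g =
  Σ (In f → In g) λ Φ →
  Σ (In f → Out g → ℕ → Maybe (Out f)) λ Ψ →
    ∀ a → Dom f a →
      Dom g (Φ a) ×
      (∀ b′ → Sol g (Φ a) b′ → Σ (Out f) λ b → (Ψ a b′ ⇓ b) × Sol f a b)

_≡W_ : Problem → Problem → Set
f ≡W g = (f ≤W g) × (g ≤W f)

IsGraph : (ℕ → ℕ → Bool) → Set
IsGraph G = (∀ i j → G i j ≡ G j i) × (∀ i → G i i ≡ false)

record FinGraph (n : ℕ) : Set where
  field
    adj   : Fin n → Fin n → Bool
    sym   : ∀ i j → adj i j ≡ adj j i
    irref : ∀ i → adj i i ≡ false

open FinGraph public

InducedSub : {n : ℕ} → FinGraph n → (ℕ → ℕ → Bool) → Set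
InducedSub {n} F G =
  Σ (Fin n → ℕ) λ e → Injective _≡_ _≡_ e × (∀ i j → adj F i j ≡ G (e i) (e j))

S : {n : ℕ} → FinGraph n → Problem
S F = record
  { In  = ℕ → ℕ → Bool
  ; Dom = IsGraph
  ; Out = ℕ
  ; Sol = λ G b → ((b ≡ 1) × InducedSub F G) ⊎ ((b ≡ 0) × ¬ InducedSub F G)
  }

LPO : Problem
LPO = record
  { In  = ℕ → ℕ
  ; Dom = λ _ → Data.Unit.⊤
  ; Out = ℕ
  ; Sol = λ p n →
      ((n ≡ 0) × (∀ j → 0 < p j)) ⊎
      (Σ ℕ λ k → (n ≡ suc k) × (p k ≡ 0) × (∀ t → t < k → 0 < p t))
  }
  where import Data.Unit

-- S_F ≤W LPO: F embeds into G iff it embeds into one of the finite graphs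
-- G ↾ {0, …, k-1}, and each of these questions is decidable, so LPO asks
-- for the first k at which the answer is yes.
--
-- LPO ≤W S_F: cut ℕ into blocks of |F| vertices. Block k carries a copy of F
-- if p k = 0; every other pair of distinct vertices gets the value opposite
-- to the adjacency of two fixed vertices u ≠ v of F. Thus F embeds into the
-- graph iff p has a zero, and a positive answer is turned into the least
-- zero by unbounded search.
module Submission where

open import Defs hiding (sym)
open import Data.Nat using (ℕ; _≤_; zero; suc; _+_; _*_; _⊔_; _<_; s≤s; NonZero)
open import Data.Nat.Properties using (_≟_; n≢0⇒n>0; m≤m⊔n; m≤n⊔m; <-≤-trans)
open import Data.Nat.DivMod
  using (_/_; _mod_; +-distrib-/-∣ʳ; m<n⇒m/n≡0; m*n/n≡m; [m+kn]%n≡m%n; m<n⇒m%n≡m)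
open import Data.Nat.Divisibility using (n∣m*n)
open import Data.Bool using (Bool; true; false; _∧_; not)
open import Data.Bool.Properties using (∧-zeroʳ; ∧-identityʳ; not-¬) renaming (_≟_ to _≟ᵇ_)
open import Data.Fin using (Fin; zero; suc; toℕ; fromℕ<)
open import Data.Fin.Properties using (toℕ-injective; toℕ-fromℕ<; toℕ<n; any?; all?)
  renaming (_≟_ to _≟ᶠ_)
open import Data.Vec.Functional using (_∷_; head; tail)
open import Data.Maybe using (Maybe; just; nothing)
open import Data.Product using (Σ; _×_; _,_; ∃)
open import Data.Sum using (inj₁; inj₂)
open import Data.Unit using (tt)
open import Data.Empty using (⊥-elim)
open import Function using (_∘_; mk⇔)
open import Function.Definitions using (Injective)
open import Relation.Nullary using (¬_; Dec; yes; no; does)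
open import Relation.Nullary.Decidable using (map′; _×-dec_; _→-dec_; dec-true; dec-false; does-⇔)
open import Relation.Binary.PropositionalEquality
  using (_≡_; _≢_; refl; sym; trans; cong; cong₂; subst; _≗_; module ≡-Reasoning)

module _ {A : Set} where

  now-⇓ : (a : A) → (λ _ → just a) ⇓ a
  now-⇓ a = 0 , refl , λ _ ()

  zeroIfYes : Dec A → ℕ
  zeroIfYes (yes _) = 0
  zeroIfYes (no _)  = 1

  zeroIfYes≡0⇒ : (a? : Dec A) → zeroIfYes a? ≡ 0 → A
  zeroIfYes≡0⇒ (yes a) _ = a

  zeroIfYes>0⇒¬ : (a? : Dec A) → 0 < zeroIfYes a? → ¬ A
  zeroIfYes>0⇒¬ (no ¬a) _ = ¬a

IsLeastZero : (ℕ → ℕ) → ℕ → Set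
IsLeastZero p k = (p k ≡ 0) × (∀ t → t < k → 0 < p t)

leastZero : ∀ p j → p j ≡ 0 → ∃ (IsLeastZero p)
leastZero p zero    pj≡0 = 0 , pj≡0 , λ _ ()
leastZero p (suc j) pj≡0 with p 0 ≟ 0
... | yes p0≡0 = 0 , p0≡0 , λ _ ()
... | no  p0≢0 with leastZero (p ∘ suc) j pj≡0
...   | k , pk≡0 , below = suc k , pk≡0 , λ where
          zero    _         → n≢0⇒n>0 p0≢0
          (suc t) (s≤s t<k) → below t t<k

stopAt : ℕ → ℕ → Maybe ℕ
stopAt s zero    = just (suc s)
stopAt s (suc _) = nothing

firstZero : (ℕ → ℕ) → ℕ → Maybe ℕ
firstZero p s = stopAt s (p s)

firstZero-⇓ : ∀ p k → IsLeastZero p k → firstZero p ⇓ suc k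
firstZero-⇓ p k (pk≡0 , below) =
  k , cong (stopAt k) pk≡0 , λ t t<k → stopped-not (below t t<k)
  where
  stopped-not : ∀ {s v} → 0 < v → stopAt s v ≡ nothing
  stopped-not (s≤s _) = refl

module _ {n : ℕ} (F : FinGraph n) where

  IsEmbedding : (ℕ → ℕ → Bool) → (Fin n → ℕ) → Set
  IsEmbedding G e = Injective _≡_ _≡_ e × (∀ i j → adj F i j ≡ G (e i) (e j))

  isEmbedding? : ∀ G e → Dec (IsEmbedding G e)
  isEmbedding? G e =
    map′ (λ inj → inj _ _) (λ inj _ _ → inj) (all? λ x → all? λ y → e x ≟ e y →-dec x ≟ᶠ y)
    ×-dec all? λ i → all? λ j → adj F i j ≟ᵇ G (e i) (e j)

  isEmbedding-resp : ∀ G {e e′} → e ≗ e′ → IsEmbedding G e → IsEmbedding G e′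
  isEmbedding-resp G {e} {e′} e≗e′ (inj , preserves) =
    (λ {x} {y} e′x≡e′y → inj (trans (e≗e′ x) (trans e′x≡e′y (sym (e≗e′ y))))) ,
    (λ i j → trans (preserves i j) (cong₂ G (e≗e′ i) (e≗e′ j)))

  EmbedsBelow : (ℕ → ℕ → Bool) → ℕ → Set
  EmbedsBelow G k = Σ (Fin n → Fin k) (IsEmbedding G ∘ (toℕ ∘_))

  embedsBelow? : ∀ G k → Dec (EmbedsBelow G k)
  embedsBelow? G k = anyFunction? n (isEmbedding-resp G ∘ (cong toℕ ∘_)) (isEmbedding? G ∘ (toℕ ∘_))
    where
    -- The hypothesis `resp` stands in for function extensionality.
    anyFunction? : ∀ m {Q : (Fin m → Fin k) → Set} →
                   (∀ {f g} → f ≗ g → Q f → Q g) → (∀ f → Dec (Q f)) → Dec (∃ Q)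
    anyFunction? zero    resp Q? with Q? (λ ())
    ... | yes q = yes (_ , q)
    ... | no ¬q = no λ (f , qf) → ¬q (resp (λ ()) qf)
    anyFunction? (suc m) resp Q? =
      map′ (λ (a , f , q) → a ∷ f , q) (λ (f , q) → head f , tail f , resp head∷tail q)
           (any? λ a → anyFunction? m (resp ∘ cons-≗ a) (Q? ∘ (a ∷_)))
      where
      cons-≗ : ∀ a {f g : Fin m → Fin k} → f ≗ g → a ∷ f ≗ a ∷ g
      cons-≗ a f≗g zero    = refl
      cons-≗ a f≗g (suc x) = f≗g x
      head∷tail : ∀ {f : Fin (suc m) → Fin k} → f ≗ head f ∷ tail f
      head∷tail zero    = refl
      head∷tail (suc x) = refl

  strictBound : ∀ {m} → (Fin m → ℕ) → ℕ
  strictBound {zero}  e = 0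
  strictBound {suc m} e = suc (head e) ⊔ strictBound (tail e)

  <-strictBound : ∀ {m} (e : Fin m → ℕ) i → e i < strictBound e
  <-strictBound {suc m} e zero    = m≤m⊔n (suc (head e)) (strictBound (tail e))
  <-strictBound {suc m} e (suc i) = <-≤-trans (<-strictBound (tail e) i) (m≤n⊔m (suc (head e)) _)

  inducedSub⇒embedsBelow : ∀ G → InducedSub F G → ∃ (EmbedsBelow G)
  inducedSub⇒embedsBelow G (e , isEmb) =
    strictBound e , bounded , isEmbedding-resp G (λ i → sym (toℕ-fromℕ< (<-strictBound e i))) isEmb
    where
    bounded : Fin n → Fin (strictBound e)
    bounded i = fromℕ< (<-strictBound e i)

  S≤W-LPO : S F ≤W LPO
  S≤W-LPO = firstEmbedding , (λ _ b _ → just (answer b)) , λ G _ → tt , solve G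
    where
    firstEmbedding : (ℕ → ℕ → Bool) → ℕ → ℕ
    firstEmbedding G k = zeroIfYes (embedsBelow? G k)

    answer : ℕ → ℕ
    answer zero    = 0
    answer (suc _) = 1

    solve : ∀ G b → Sol LPO (firstEmbedding G) b →
            Σ ℕ λ a → ((λ _ → just (answer b)) ⇓ a) × Sol (S F) G a
    solve G .0 (inj₁ (refl , none)) = 0 , now-⇓ 0 , inj₂ (refl , λ sub →
      let (k , below) = inducedSub⇒embedsBelow G sub
      in  zeroIfYes>0⇒¬ (embedsBelow? G k) (none k) below)
    solve G .(suc k) (inj₂ (k , refl , first , _)) = 1 , now-⇓ 1 , inj₁ (refl ,
      let (f , isEmb) = zeroIfYes≡0⇒ (embedsBelow? G k) first
      in  toℕ ∘ f , isEmb)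

module BlockGraph {n : ℕ} (F : FinGraph n) .{{_ : NonZero n}} (u v : Fin n) (u≢v : u ≢ v) where

  block : ℕ → ℕ
  block i = i / n

  offset : ℕ → Fin n
  offset i = i mod n

  vertex : ℕ → Fin n → ℕ
  vertex k x = toℕ x + k * n

  block-vertex : ∀ k x → block (vertex k x) ≡ k
  block-vertex k x = trans (+-distrib-/-∣ʳ (toℕ x) (n∣m*n k))
                           (cong₂ _+_ (m<n⇒m/n≡0 (toℕ<n x)) (m*n/n≡m k n))

  offset-vertex : ∀ k x → offset (vertex k x) ≡ x
  offset-vertex k x = toℕ-injective (trans (toℕ-fromℕ< _)
                        (trans ([m+kn]%n≡m%n (toℕ x) k n) (m<n⇒m%n≡m (toℕ<n x))))

  vertex-injective : ∀ k → Injective _≡_ _≡_ (vertex k)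
  vertex-injective k {x} {y} eq =
    trans (sym (offset-vertex k x)) (trans (cong offset eq) (offset-vertex k y))

  SameMarkedBlock : (ℕ → ℕ) → ℕ → ℕ → Set
  SameMarkedBlock p i j = (block i ≡ block j) × (p (block i) ≡ 0)

  sameMarkedBlock? : ∀ p i j → Dec (SameMarkedBlock p i j)
  sameMarkedBlock? p i j = block i ≟ block j ×-dec p (block i) ≟ 0

  sameMarkedBlock-sym : ∀ p {i j} → SameMarkedBlock p i j → SameMarkedBlock p j i
  sameMarkedBlock-sym p (bi≡bj , marked) = sym bi≡bj , subst (λ b → p b ≡ 0) bi≡bj marked

  background : Bool
  background = not (adj F u v)

  edge : Bool → Fin n → Fin n → Bool → Bool
  edge true  x y _    = adj F x y
  edge false _ _ same = background ∧ not same

  edge-swap : ∀ marked x y same → edge marked x y same ≡ edge marked y x same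
  edge-swap true  x y _ = FinGraph.sym F x y
  edge-swap false _ _ _ = refl

  graph : (ℕ → ℕ) → ℕ → ℕ → Bool
  graph p i j = edge (does (sameMarkedBlock? p i j)) (offset i) (offset j) (does (i ≟ j))

  graph-isGraph : ∀ p → IsGraph (graph p)
  graph-isGraph p = symmetric , irreflexive
    where
    symmetric : ∀ i j → graph p i j ≡ graph p j i
    symmetric i j = begin
      edge (does (sameMarkedBlock? p i j)) (offset i) (offset j) (does (i ≟ j))
        ≡⟨ cong₂ (λ marked → edge marked (offset i) (offset j))
             (does-⇔ (mk⇔ (sameMarkedBlock-sym p) (sameMarkedBlock-sym p))
               (sameMarkedBlock? p i j) (sameMarkedBlock? p j i))
             (does-⇔ (mk⇔ sym sym) (i ≟ j) (j ≟ i)) ⟩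
      edge (does (sameMarkedBlock? p j i)) (offset i) (offset j) (does (j ≟ i))
        ≡⟨ edge-swap (does (sameMarkedBlock? p j i)) (offset i) (offset j) (does (j ≟ i)) ⟩
      edge (does (sameMarkedBlock? p j i)) (offset j) (offset i) (does (j ≟ i))
        ∎
      where open ≡-Reasoning
    irreflexive : ∀ i → graph p i i ≡ false
    irreflexive i with does (sameMarkedBlock? p i i)
    ... | true  = irref F (offset i)
    ... | false = trans (cong (λ same → background ∧ not same) (dec-true (i ≟ i) refl))
                        (∧-zeroʳ background)

  marked⇒inducedSub : ∀ p k → p k ≡ 0 → InducedSub F (graph p)
  marked⇒inducedSub p k pk≡0 = vertex k , vertex-injective k , copy
    where
    copy : ∀ x y → adj F x y ≡ graph p (vertex k x) (vertex k y)
    copy x y = sym (trans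
      (cong (λ marked → edge marked _ _ _)
        (dec-true (sameMarkedBlock? p (vertex k x) (vertex k y))
          (trans (block-vertex k x) (sym (block-vertex k y)) ,
           subst (λ b → p b ≡ 0) (sym (block-vertex k x)) pk≡0)))
      (cong₂ (adj F) (offset-vertex k x) (offset-vertex k y)))

  unmarked-background : ∀ p {i j} → i ≢ j → ¬ SameMarkedBlock p i j → graph p i j ≡ background
  unmarked-background p {i} {j} i≢j unmarked = begin
    graph p i j                           ≡⟨ cong₂ (λ marked → edge marked _ _)
                                               (dec-false (sameMarkedBlock? p i j) unmarked)
                                               (dec-false (i ≟ j) i≢j) ⟩
    background ∧ true                     ≡⟨ ∧-identityʳ background ⟩
    background                            ∎
    where open ≡-Reasoning

  inducedSub⇒zero : ∀ p → InducedSub F (graph p) → ∃ λ t → p t ≡ 0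
  inducedSub⇒zero p (e , inj , preserves) with sameMarkedBlock? p (e u) (e v)
  ... | yes (_ , marked) = block (e u) , marked
  ... | no unmarked =
    ⊥-elim (not-¬ refl (trans (preserves u v) (unmarked-background p (u≢v ∘ inj) unmarked)))

  LPO≤W-S : LPO ≤W S F
  LPO≤W-S = graph , search , λ p _ → graph-isGraph p , solve p
    where
    search : (ℕ → ℕ) → ℕ → ℕ → Maybe ℕ
    search p zero    = λ _ → just 0
    search p (suc _) = firstZero p

    solve : ∀ p a → Sol (S F) (graph p) a → Σ ℕ λ b → (search p a ⇓ b) × Sol LPO p b
    solve p .1 (inj₁ (refl , sub)) =
      let (j , pj≡0) = inducedSub⇒zero p sub
          (k , least) = leastZero p j pj≡0
      in  suc k , firstZero-⇓ p k least , inj₂ (k , refl , least)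
    solve p .0 (inj₂ (refl , ¬sub)) =
      0 , now-⇓ 0 , inj₁ (refl , λ j → n≢0⇒n>0 (¬sub ∘ marked⇒inducedSub p j))

theorem28 : (n : ℕ) → 2 ≤ n → (F : FinGraph n) → S F ≡W LPO
theorem28 _ (s≤s (s≤s _)) F = S≤W-LPO F , BlockGraph.LPO≤W-S F zero (suc zero) λ ()
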